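{- Let $G$ be a connected simple subcubic graph different from $K_2$. If the set of all vertices of degree three in $G$ is an independent set, then $\operatorname{lir}(^2G) \leq 2$.
   Context: All graphs are finite and without loops. A graph is subcubic if its maximum degree is at most three. A multigraph $M$ consists of a nonempty finite vertex set and a multiset of edges (2-element subsets of the vertex set); the degree of a vertex is the sum of the multiplicities of the edges incident to it. For a simple graph $G$, $^2G$ denotes the 2-multigraph obtained from $G$ by replacing each edge of $G$ with two parallel edges. A multigraph is locally irregular if every two adjacent vertices have different degrees. An edge coloring of a multigraph $M$ assigns a color to each element of the edge multiset (it need not be proper, and parallel edges may receive different colors); it is locally irregular if, for each color, the submultigraph of $M$ induced by the edges of that color is locally irregular. The locally irregular chromatic index $\operatorname{lir}(M)$ is the smallest number of colors in a locally irregular edge coloring of $M$, if one exists; so $\operatorname{lir}(M)\leq k$ means that $M$ has a locally irregular edge coloring using at most $k$ colors. -}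

module Defs where

import Algebra.Properties.CommutativeMonoid.Sum
open import Data.Bool.Base using (if_then_else_)
open import Data.Fin.Base using (Fin; _<_)
open import Data.Fin.Properties using (_≟_; <-cmp)
open import Data.Nat.Base as ℕ using (ℕ; NonZero; _≤_; _*_)
open import Data.Nat.Properties using (+-0-commutativeMonoid)
open import Data.Product.Base using (Σ-syntax)
open import Data.Vec.Base using (count; allFin)
open import Function.Bundles using (_↔_; Inverse)
open import Level using (0ℓ)
open import Relation.Binary.Construct.Closure.ReflexiveTransitive using (Star)
open import Relation.Binary.Core using (Rel)
open import Relation.Binary.Definitions using (tri<; tri≈; tri>)
open import Relation.Binary.PropositionalEquality
  using (_≡_; _≢_; refl; sym; cong)
open import Relation.Nullary using (¬_; does; yes; no; contradiction)
open import Relation.Unary using (Pred)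

open Algebra.Properties.CommutativeMonoid.Sum +-0-commutativeMonoid
  using (sum) public

-- The multiset of edges is given by its multiplicity function:
-- mult u v is the number of copies of the 2-element set {u, v}.
record Multigraph (n : ℕ) : Set where
  field
    nonEmpty  : NonZero n
    mult      : Fin n → Fin n → ℕ
    mult-sym  : ∀ u v → mult u v ≡ mult v u
    mult-loop : ∀ v → mult v v ≡ 0

  Adjacent : Rel (Fin n) 0ℓ
  Adjacent u v = 1 ≤ mult u v

  degree : Fin n → ℕ
  degree u = sum (λ v → mult u v)

  -- A simple graph is a multigraph without parallel edges.
  Simple : Set
  Simple = ∀ u v → mult u v ≤ 1

  Connected : Set
  Connected = ∀ u v → Star Adjacent u v

  Subcubic : Set
  Subcubic = ∀ v → degree v ≤ 3

  Independent : Pred (Fin n) 0ℓ → Set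
  Independent S = ∀ u v → S u → S v → ¬ Adjacent u v

  LocallyIrregular : Set
  LocallyIrregular = ∀ u v → Adjacent u v → degree u ≢ degree v

open Multigraph public

record _≅_ {m n : ℕ} (G : Multigraph m) (H : Multigraph n) : Set where
  field
    vertices      : Fin m ↔ Fin n
    mult-preserve : ∀ u v →
      mult H (Inverse.to vertices u) (Inverse.to vertices v) ≡ mult G u v

complete : (n : ℕ) .{{_ : NonZero n}} → Multigraph n
complete n .nonEmpty = ℕ.>-nonZero (ℕ.>-nonZero⁻¹ n)
complete n .mult u v = if does (u ≟ v) then 0 else 1
complete n .mult-sym u v with u ≟ v | v ≟ u
... | yes _  | yes _  = refl
... | yes eq | no neq = contradiction (sym eq) neq
... | no neq | yes eq = contradiction (sym eq) neq
... | no _   | no _   = refl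
complete n .mult-loop v with v ≟ v
... | yes _  = refl
... | no neq = contradiction refl neq

²_ : ∀ {n} → Multigraph n → Multigraph n
(² G) .nonEmpty      = nonEmpty G
(² G) .mult u v      = 2 * mult G u v
(² G) .mult-sym u v  = cong (2 *_) (mult-sym G u v)
(² G) .mult-loop v   = cong (2 *_) (mult-loop G v)

-- Elements of the edge multiset: a 2-element set of vertices, listed in
-- increasing order so that it occurs once, and one of its parallel copies.
record Edge {n : ℕ} (M : Multigraph n) : Set where
  constructor edge
  field
    end₁ end₂ : Fin n
    .ordered  : end₁ < end₂
    copy      : Fin (mult M end₁ end₂)

EdgeColouring : ∀ {n} → Multigraph n → ℕ → Set
EdgeColouring M k = Edge M → Fin k

module _ {n k : ℕ} (M : Multigraph n) (c : EdgeColouring M k) (a : Fin k) where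

  copiesColoured : (u v : Fin n) → .(u < v) → ℕ
  copiesColoured u v u<v =
    count (λ i → c (edge u v u<v i) ≟ a) (allFin (mult M u v))

  colourMult : (u v : Fin n) → ℕ
  colourMult u v with <-cmp u v
  ... | tri< u<v _ _ = copiesColoured u v u<v
  ... | tri≈ _ _ _   = 0
  ... | tri> _ _ v<u = copiesColoured v u v<u

  -- The submultigraph induced by the edges of colour a.  Vertices not
  -- incident to such an edge are kept as isolated vertices; they affect
  -- neither adjacency nor the degrees of the other vertices.
  colourClass : Multigraph n
  colourClass .nonEmpty = nonEmpty M
  colourClass .mult = colourMult
  colourClass .mult-sym u v with <-cmp u v | <-cmp v u
  ... | tri< _ _ _   | tri> _ _ _   = refl
  ... | tri> _ _ _   | tri< _ _ _   = refl
  ... | tri≈ _ _ _   | tri≈ _ _ _   = refl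
  ... | tri< p _ _   | tri< _ _ ¬p  = contradiction p ¬p
  ... | tri< _ ¬e _  | tri≈ _ e _   = contradiction (sym e) ¬e
  ... | tri≈ _ e _   | tri< _ ¬e _  = contradiction (sym e) ¬e
  ... | tri≈ _ e _   | tri> _ ¬e _  = contradiction (sym e) ¬e
  ... | tri> _ ¬e _  | tri≈ _ e _   = contradiction (sym e) ¬e
  ... | tri> _ _ p   | tri> ¬p _ _  = contradiction p ¬p
  colourClass .mult-loop v with <-cmp v v
  ... | tri< _ ¬e _ = contradiction refl ¬e
  ... | tri≈ _ _ _  = refl
  ... | tri> _ ¬e _ = contradiction refl ¬e

IsLocallyIrregular : ∀ {n k} (M : Multigraph n) → EdgeColouring M k → Set
IsLocallyIrregular M c = ∀ a → LocallyIrregular (colourClass M c a)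

-- lir(M) ≤ k: a colouring with palette Fin k uses at most k colours.
Lir≤ : ∀ {n} → Multigraph n → ℕ → Set
Lir≤ M k = Σ[ c ∈ EdgeColouring M k ] IsLocallyIrregular M c

{-# OPTIONS --safe #-}

-- Each edge of G gets a colour for both copies (pure) or one copy of each colour
-- (mixed).  If uv joins two vertices of degree two, local irregularity at uv says
-- exactly that the other edge at u and the other edge at v are treated differently.
-- A vertex of degree three causes no conflict when all its edges are pure in a common
-- colour, its type; one of them may also be mixed, provided that the next edge is not
-- pure in that type.  Mixing is needed only on paths of length three between two
-- vertices of the same type.  Choosing the types greedily along the vertices, in the
-- minority among earlier demands, each vertex has to mix at most one edge.  Edges at
-- leaves are then coloured explicitly, and edges between vertices of degree two
-- greedily: each end forbids only one of the three options.

module Submission where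

open import Defs
open import Data.Bool.Base using (if_then_else_; true; false)
open import Data.Fin.Base as Fin using (Fin; toℕ; combine; opposite)
open import Data.Fin.Patterns using (0F; 1F)
open import Data.Fin.Properties as Fin
  using (_≟_; any?; <-cmp; combine-injective; toℕ-injective; opposite-involutive)
open import Data.Maybe.Base using (Maybe; just; nothing)
open import Data.Maybe.Properties using (just-injective)
open import Data.Nat.Base as ℕ using (ℕ; zero; suc; _+_; _*_; _≤_; _<_; z≤n; s≤s)
open import Data.Nat.Properties as ℕ hiding (_≟_; <-cmp)
open import Data.Product.Base using (∃-syntax; _×_; _,_; proj₁; proj₂)
open import Data.Sum.Base using (_⊎_; inj₁; inj₂)
open import Data.Vec.Base using (count; allFin)
open import Function.Base using (_∘_)
open import Function.Bundles using (mk↔ₛ′)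
open import Relation.Binary.Construct.Closure.ReflexiveTransitive using (Star; ε; _◅_)
open import Relation.Binary.Definitions using (Tri; tri<; tri≈; tri>)
open import Relation.Binary.PropositionalEquality
open import Relation.Nullary using (¬_; Dec; does; yes; no; contradiction)
open import Relation.Nullary.Decidable using (¬?; _×-dec_; dec-true; dec-false)
open import Algebra.Properties.CommutativeMonoid.Sum +-0-commutativeMonoid
  using (sum-cong-≗; ∑-distrib-+)

private variable
  n : ℕ

-- Sums with few nonzero terms

except : Fin n → (Fin n → ℕ) → Fin n → ℕ
except u f z = if does (z ≟ u) then 0 else f z

except-≢ : (f : Fin n → ℕ) {u z : Fin n} → z ≢ u → except u f z ≡ f z
except-≢ f {u} {z} z≢u rewrite dec-false (z ≟ u) z≢u = refl

sum-except : (f : Fin n → ℕ) (u : Fin n) → sum f ≡ f u + sum (except u f)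
sum-except f Fin.zero = refl
sum-except f (Fin.suc u) = begin
  f 0F + sum (f ∘ Fin.suc)                  ≡⟨ cong (f 0F +_) (sum-except (f ∘ Fin.suc) u) ⟩
  f 0F + (f (Fin.suc u) + rest)             ≡⟨ +-assoc (f 0F) _ rest ⟨
  f 0F + f (Fin.suc u) + rest               ≡⟨ cong (_+ rest) (+-comm (f 0F) _) ⟩
  f (Fin.suc u) + f 0F + rest               ≡⟨ +-assoc (f (Fin.suc u)) _ rest ⟩
  f (Fin.suc u) + (f 0F + rest)             ∎
  where
  open ≡-Reasoning
  rest = sum (except u (f ∘ Fin.suc))

sum-zero : (f : Fin n → ℕ) → (∀ z → f z ≡ 0) → sum f ≡ 0
sum-zero {zero}  f f≡0 = refl
sum-zero {suc n} f f≡0 = cong₂ _+_ (f≡0 0F) (sum-zero (f ∘ Fin.suc) (f≡0 ∘ Fin.suc))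

sum-mono-≤ : {f g : Fin n → ℕ} → (∀ z → f z ≤ g z) → sum f ≤ sum g
sum-mono-≤ {zero}  f≤g = z≤n
sum-mono-≤ {suc n} f≤g = +-mono-≤ (f≤g 0F) (sum-mono-≤ (f≤g ∘ Fin.suc))

term≤sum : (f : Fin n → ℕ) (u : Fin n) → f u ≤ sum f
term≤sum f u = subst (f u ≤_) (sym (sum-except f u)) (m≤m+n _ _)

terms₂≤sum : (f : Fin n → ℕ) {u v : Fin n} → v ≢ u → f u + f v ≤ sum f
terms₂≤sum f {u} {v} v≢u = subst (f u + f v ≤_) (sym (sum-except f u))
  (+-monoʳ-≤ (f u) (subst (_≤ sum (except u f)) (except-≢ f v≢u) (term≤sum (except u f) v)))

terms₃≤sum : (f : Fin n → ℕ) {u v w : Fin n} → v ≢ u → w ≢ u → w ≢ v →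
             f u + (f v + f w) ≤ sum f
terms₃≤sum f {u} {v} {w} v≢u w≢u w≢v = subst (f u + (f v + f w) ≤_) (sym (sum-except f u))
  (+-monoʳ-≤ (f u) (subst (_≤ sum (except u f)) (cong₂ _+_ (except-≢ f v≢u) (except-≢ f w≢u))
    (terms₂≤sum (except u f) w≢v)))

sum-support₁ : (f : Fin n → ℕ) (u : Fin n) → (∀ z → z ≢ u → f z ≡ 0) → sum f ≡ f u
sum-support₁ f u zero-off = begin
  sum f                    ≡⟨ sum-except f u ⟩
  f u + sum (except u f)   ≡⟨ cong (f u +_) (sum-zero (except u f) except-zero) ⟩
  f u + 0                  ≡⟨ +-identityʳ _ ⟩
  f u                      ∎
  where
  open ≡-Reasoning
  except-zero : ∀ z → except u f z ≡ 0
  except-zero z with z ≟ u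
  ... | yes _  = refl
  ... | no z≢u = zero-off z z≢u

sum-support₂ : (f : Fin n → ℕ) {u v : Fin n} → v ≢ u →
               (∀ z → z ≢ u → z ≢ v → f z ≡ 0) → sum f ≡ f u + f v
sum-support₂ f {u} {v} v≢u zero-off = begin
  sum f                    ≡⟨ sum-except f u ⟩
  f u + sum (except u f)   ≡⟨ cong (f u +_) (sum-support₁ (except u f) v except-zero) ⟩
  f u + except u f v       ≡⟨ cong (f u +_) (except-≢ f v≢u) ⟩
  f u + f v                ∎
  where
  open ≡-Reasoning
  except-zero : ∀ z → z ≢ v → except u f z ≡ 0
  except-zero z z≢v with z ≟ u
  ... | yes _  = refl
  ... | no z≢u = zero-off z z≢u z≢v

-- Greedy choice along a rank function

-- Elements are processed by increasing rank; those of equal rank do not see each other.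
module Greedy {E A : Set} (rank : E → ℕ) (default : A) (choose : E → (E → A) → A) where

  upTo : ℕ → E → A
  upTo zero    e = default
  upTo (suc k) e = if does (rank e ℕ.≟ k) then choose e (upTo k) else upTo k e

  before : E → E → A
  before e = upTo (rank e)

  greedy : E → A
  greedy e = choose e (before e)

  -- An entry is rewritten only in the round given by its rank, so it is final in all later rounds.
  upTo-greedy : ∀ k e → rank e < k → upTo k e ≡ greedy e
  upTo-greedy (suc k) e (s≤s r≤k) with rank e ℕ.≟ k
  ... | yes refl rewrite dec-true (rank e ℕ.≟ rank e) refl = refl
  ... | no r≢k   rewrite dec-false (rank e ℕ.≟ k) r≢k = upTo-greedy k e (≤∧≢⇒< r≤k r≢k)

  before-greedy : ∀ {e e′} → rank e′ < rank e → before e e′ ≡ greedy e′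
  before-greedy {e} {e′} = upTo-greedy (rank e) e′

-- The three treatments of a doubled edge

-- just a: both copies of the edge have colour a; nothing: one copy of each colour.
Colour : Set
Colour = Maybe (Fin 2)

copies : Fin 2 → Colour → ℕ
copies a (just b) = if does (b ≟ a) then 2 else 0
copies a nothing  = 1

paint : Colour → ℕ → Fin 2
paint (just a) _       = a
paint nothing  zero    = 0F
paint nothing  (suc _) = 1F

count-paint : ∀ m → m ≤ 1 → ∀ κ a →
  count (λ (i : Fin (2 * m)) → paint κ (toℕ i) ≟ a) (allFin (2 * m)) ≡ m * copies a κ
count-paint zero          _ κ         a  = refl
count-paint (suc zero)    _ (just 0F) 0F = refl
count-paint (suc zero)    _ (just 0F) 1F = refl
count-paint (suc zero)    _ (just 1F) 0F = refl
count-paint (suc zero)    _ (just 1F) 1F = refl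
count-paint (suc zero)    _ nothing   0F = refl
count-paint (suc zero)    _ nothing   1F = refl
count-paint (suc (suc _)) (s≤s ()) _ _

decode : Fin 2 → ℕ → Colour
decode a 0 = just (opposite a)
decode a 1 = nothing
decode a _ = just a

decode-copies : ∀ a κ → decode a (copies a κ) ≡ κ
decode-copies 0F (just 0F) = refl
decode-copies 0F (just 1F) = refl
decode-copies 1F (just 0F) = refl
decode-copies 1F (just 1F) = refl
decode-copies _  nothing   = refl

copies-injective : ∀ a {κ κ′} → copies a κ ≡ copies a κ′ → κ ≡ κ′
copies-injective a {κ} {κ′} eq =
  trans (sym (decode-copies a κ)) (trans (cong (decode a) eq) (decode-copies a κ′))

copies≤2 : ∀ a κ → copies a κ ≤ 2
copies≤2 0F (just 0F) = s≤s (s≤s z≤n)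
copies≤2 0F (just 1F) = z≤n
copies≤2 1F (just 0F) = z≤n
copies≤2 1F (just 1F) = s≤s (s≤s z≤n)
copies≤2 _  nothing   = s≤s z≤n

copies-complement : ∀ a κ → copies a κ + copies (opposite a) κ ≡ 2
copies-complement 0F (just 0F) = refl
copies-complement 0F (just 1F) = refl
copies-complement 1F (just 0F) = refl
copies-complement 1F (just 1F) = refl
copies-complement 0F nothing   = refl
copies-complement 1F nothing   = refl

copies-just : ∀ {a b} → 1 ≤ copies a (just b) → b ≡ a
copies-just {0F} {0F} _ = refl
copies-just {1F} {1F} _ = refl

1≤copies : ∀ {a κ} → κ ≢ just (opposite a) → 1 ≤ copies a κ
1≤copies {_}  {nothing} _ = s≤s z≤n
1≤copies {0F} {just 0F} _ = s≤s z≤n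
1≤copies {0F} {just 1F} ≢ = contradiction refl ≢
1≤copies {1F} {just 0F} ≢ = contradiction refl ≢
1≤copies {1F} {just 1F} _ = s≤s z≤n

opposite-≢ : ∀ (a : Fin 2) → a ≢ opposite a
opposite-≢ 0F ()
opposite-≢ 1F ()

≡-or-opposite : ∀ (a b : Fin 2) → b ≡ a ⊎ b ≡ opposite a
≡-or-opposite 0F 0F = inj₁ refl
≡-or-opposite 0F 1F = inj₂ refl
≡-or-opposite 1F 0F = inj₂ refl
≡-or-opposite 1F 1F = inj₁ refl

avoid : Colour → Colour → Colour
avoid (just 0F) (just 1F) = nothing
avoid (just 1F) (just 0F) = nothing
avoid (just 0F) _         = just 1F
avoid (just 1F) _         = just 0F
avoid nothing   (just 0F) = just 1F
avoid nothing   _         = just 0F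

avoid-≢ˡ : ∀ κ κ′ → avoid κ κ′ ≢ κ
avoid-≢ˡ (just 0F) (just 0F) ()
avoid-≢ˡ (just 0F) (just 1F) ()
avoid-≢ˡ (just 0F) nothing   ()
avoid-≢ˡ (just 1F) (just 0F) ()
avoid-≢ˡ (just 1F) (just 1F) ()
avoid-≢ˡ (just 1F) nothing   ()
avoid-≢ˡ nothing   (just 0F) ()
avoid-≢ˡ nothing   (just 1F) ()
avoid-≢ˡ nothing   nothing   ()

avoid-≢ʳ : ∀ κ κ′ → avoid κ κ′ ≢ κ′
avoid-≢ʳ (just 0F) (just 0F) ()
avoid-≢ʳ (just 0F) (just 1F) ()
avoid-≢ʳ (just 0F) nothing   ()
avoid-≢ʳ (just 1F) (just 0F) ()
avoid-≢ʳ (just 1F) (just 1F) ()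
avoid-≢ʳ (just 1F) nothing   ()
avoid-≢ʳ nothing   (just 0F) ()
avoid-≢ʳ nothing   (just 1F) ()
avoid-≢ʳ nothing   nothing   ()

demand : Fin 2 → Maybe (Fin 2) → ℕ
demand a (just b) = if does (b ≟ a) then 1 else 0
demand a nothing  = 0

demand-total : ∀ m → demand 0F m + demand 1F m ≤ 1
demand-total (just 0F) = s≤s z≤n
demand-total (just 1F) = s≤s z≤n
demand-total nothing   = z≤n

-- The colour of an edge at a vertex of type a, where the edge has to be mixed if the
-- type is m.
typed : Fin 2 → Maybe (Fin 2) → Colour
typed a (just b) = if does (b ≟ a) then nothing else just a
typed a nothing  = just a

-- An edge at a vertex of type `a` carries the opposite colour only if mixed, and then in one copy.
-- The degree of the vertex in that colour thus counts the demands for `a`.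
copies-typed : ∀ a m → copies (opposite a) (typed a m) ≡ demand a m
copies-typed 0F (just 0F) = refl
copies-typed 0F (just 1F) = refl
copies-typed 1F (just 0F) = refl
copies-typed 1F (just 1F) = refl
copies-typed 0F nothing   = refl
copies-typed 1F nothing   = refl

typed-cases : ∀ a m → typed a m ≡ just a ⊎ typed a m ≡ nothing
typed-cases 0F (just 0F) = inj₂ refl
typed-cases 0F (just 1F) = inj₁ refl
typed-cases 1F (just 0F) = inj₁ refl
typed-cases 1F (just 1F) = inj₂ refl
typed-cases a  nothing   = inj₁ refl

typed-opposite : ∀ a b → typed a (just b) ≢ typed a (just (opposite b))
typed-opposite 0F 0F ()
typed-opposite 0F 1F ()
typed-opposite 1F 0F ()
typed-opposite 1F 1F ()

just-≢-typed : ∀ a b → just a ≢ typed b (just a)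
just-≢-typed 0F 0F ()
just-≢-typed 0F 1F ()
just-≢-typed 1F 0F ()
just-≢-typed 1F 1F ()

-- Breaking symmetry, and unordered pairs in canonical form

order : Fin n → Fin n → Fin 2
order u v = if does (u Fin.<? v) then 0F else 1F

order-opposite : {u v : Fin n} → u ≢ v → order v u ≡ opposite (order u v)
order-opposite {u = u} {v} u≢v with <-cmp u v
... | tri< u<v _ v≮u rewrite dec-true (u Fin.<? v) u<v | dec-false (v Fin.<? u) v≮u = refl
... | tri≈ _ u≡v _   = contradiction u≡v u≢v
... | tri> u≮v _ v<u rewrite dec-false (u Fin.<? v) u≮v | dec-true (v Fin.<? u) v<u = refl

sort : Fin n → Fin n → Fin n × Fin n
sort u v with <-cmp u v
... | tri< _ _ _ = u , v
... | tri≈ _ _ _ = u , v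
... | tri> _ _ _ = v , u

sort-cases : (u v : Fin n) → sort u v ≡ (u , v) ⊎ sort u v ≡ (v , u)
sort-cases u v with <-cmp u v
... | tri< _ _ _ = inj₁ refl
... | tri≈ _ _ _ = inj₁ refl
... | tri> _ _ _ = inj₂ refl

sort-sym : (u v : Fin n) → sort u v ≡ sort v u
sort-sym u v with <-cmp u v | <-cmp v u
... | tri< _ _ _   | tri> _ _ _   = refl
... | tri> _ _ _   | tri< _ _ _   = refl
... | tri≈ _ e _   | tri≈ _ _ _   = cong₂ _,_ e (sym e)
... | tri< p _ _   | tri< _ _ ¬p  = contradiction p ¬p
... | tri< _ ¬e _  | tri≈ _ e _   = contradiction (sym e) ¬e
... | tri≈ _ e _   | tri< _ ¬e _  = contradiction (sym e) ¬e
... | tri≈ _ e _   | tri> _ ¬e _  = contradiction (sym e) ¬e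
... | tri> _ ¬e _  | tri≈ _ e _   = contradiction (sym e) ¬e
... | tri> _ _ p   | tri> ¬p _ _  = contradiction p ¬p

sort-≢ : {u p v q : Fin n} → v ≢ u → v ≢ p → sort u p ≢ sort v q
sort-≢ {u = u} {p} {v} {q} v≢u v≢p eq with sort-cases u p | sort-cases v q
... | inj₁ e | inj₁ f = v≢u (cong proj₁ (trans (sym f) (trans (sym eq) e)))
... | inj₁ e | inj₂ f = v≢p (cong proj₂ (trans (sym f) (trans (sym eq) e)))
... | inj₂ e | inj₁ f = v≢p (cong proj₁ (trans (sym f) (trans (sym eq) e)))
... | inj₂ e | inj₂ f = v≢u (cong proj₂ (trans (sym f) (trans (sym eq) e)))

-- Neighbours of vertices of small degree

module Neighbours (G : Multigraph n) (simple : Simple G) where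

  Adj : Fin n → Fin n → Set
  Adj = Adjacent G

  deg : Fin n → ℕ
  deg = degree G

  Adj-sym : ∀ {u v} → Adj u v → Adj v u
  Adj-sym {u} {v} = subst (1 ≤_) (mult-sym G u v)

  Adj-≢ : ∀ {u v} → Adj u v → u ≢ v
  Adj-≢ {u} 1≤ refl with () ← subst (1 ≤_) (mult-loop G u) 1≤

  Adj-mult : ∀ {u v} → Adj u v → mult G u v ≡ 1
  Adj-mult {u} {v} = ≤-antisym (simple u v)

  ¬Adj-mult : ∀ {u v} → ¬ Adj u v → mult G u v ≡ 0
  ¬Adj-mult = n<1⇒n≡0 ∘ ≰⇒>

  Adj⇒1≤deg : ∀ {u v} → Adj u v → 1 ≤ deg u
  Adj⇒1≤deg {u} {v} uv = ≤-trans uv (term≤sum (mult G u) v)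

  deg₁-unique : ∀ {u v z} → deg u ≡ 1 → Adj u v → Adj u z → z ≡ v
  deg₁-unique {u} {v} {z} d uv uz with z ≟ v
  ... | yes z≡v = z≡v
  ... | no z≢v = contradiction
    (subst (2 ≤_) d (≤-trans (+-mono-≤ uv uz) (terms₂≤sum (mult G u) z≢v))) λ { (s≤s ()) }

  deg₂-unique : ∀ {u v w z} → deg u ≡ 2 → Adj u v → Adj u w → w ≢ v → Adj u z → z ≢ v → z ≡ w
  deg₂-unique {u} {v} {w} {z} d uv uw w≢v uz z≢v with z ≟ w
  ... | yes z≡w = z≡w
  ... | no z≢w = contradiction
    (subst (3 ≤_) d (≤-trans (+-mono-≤ uv (+-mono-≤ uw uz)) (terms₃≤sum (mult G u) w≢v z≢v z≢w)))
    λ { (s≤s (s≤s ())) }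

  another? : ∀ v u → Dec (∃[ w ] (Adj v w × w ≢ u))
  another? v u = any? (λ w → (1 ≤? mult G v w) ×-dec ¬? (w ≟ u))

  -- Meaningful only when v has degree two and u is a neighbour of v.
  other : Fin n → Fin n → Fin n
  other v u with another? v u
  ... | yes (w , _) = w
  ... | no _        = v

  other-spec : ∀ {v u} → deg v ≡ 2 → Adj v u → Adj v (other v u) × other v u ≢ u
  other-spec {v} {u} d vu with another? v u
  ... | yes (_ , spec) = spec
  -- Without a second neighbour, degree two would mean a double edge to `u`.
  ... | no ¬∃ = contradiction (subst (_≤ 1) two (simple v u)) λ { (s≤s ()) }
    where
    two : mult G v u ≡ 2
    two = trans (sym (sum-support₁ (mult G v) u λ z z≢u → ¬Adj-mult λ vz → ¬∃ (z , vz , z≢u))) d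

  other-Adj : ∀ {v u} → deg v ≡ 2 → Adj v u → Adj v (other v u)
  other-Adj d vu = proj₁ (other-spec d vu)

  other-≢ : ∀ {v u} → deg v ≡ 2 → Adj v u → other v u ≢ u
  other-≢ d vu = proj₂ (other-spec d vu)

  other-unique : ∀ {v u w} → deg v ≡ 2 → Adj v u → Adj v w → w ≢ u → other v u ≡ w
  other-unique d vu vw w≢u = deg₂-unique d vu vw w≢u (other-Adj d vu) (other-≢ d vu)

  other-involutive : ∀ {v u} → deg v ≡ 2 → Adj v u → other v (other v u) ≡ u
  other-involutive d vu = other-unique d (other-Adj d vu) vu (other-≢ d vu ∘ sym)

  -- The sum of `f` over the neighbours of `v`: the multiplicities are 0 or 1, and values of `f` at
  -- other vertices cancel.
  weight : (Fin n → ℕ) → Fin n → ℕ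
  weight f v = sum (λ z → mult G v z * f z)

  weight₁ : ∀ f {v u} → deg v ≡ 1 → Adj v u → weight f v ≡ f u
  weight₁ f {v} {u} d vu = trans
    (sum-support₁ _ u λ z z≢u → cong (_* f z) (¬Adj-mult (z≢u ∘ deg₁-unique d vu)))
    (trans (cong (_* f u) (Adj-mult vu)) (*-identityˡ _))

  weight₂ : ∀ f {v u} → deg v ≡ 2 → Adj v u → weight f v ≡ f u + f (other v u)
  weight₂ f {v} {u} d vu = trans
    (sum-support₂ _ (other-≢ d vu) λ z z≢u z≢w → cong (_* f z)
      (¬Adj-mult λ vz → z≢w (sym (other-unique d vu vz z≢u))))
    (cong₂ _+_ (term vu) (term (other-Adj d vu)))
    where
    term : ∀ {z} → Adj v z → mult G v z * f z ≡ f z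
    term {z} vz = trans (cong (_* f z) (Adj-mult vz)) (*-identityˡ _)

  weight-cong : ∀ {f g v} → (∀ {z} → Adj v z → f z ≡ g z) → weight f v ≡ weight g v
  weight-cong {f} {g} {v} f≡g = sum-cong-≗ pointwise
    where
    pointwise : ∀ z → mult G v z * f z ≡ mult G v z * g z
    pointwise z with 1 ≤? mult G v z
    ... | yes vz = cong (mult G v z *_) (f≡g vz)
    ... | no ¬vz rewrite ¬Adj-mult ¬vz = refl

  weight-+ : ∀ f g v → weight f v + weight g v ≡ weight (λ z → f z + g z) v
  weight-+ f g v = trans (sym (∑-distrib-+ (λ z → mult G v z * f z) (λ z → mult G v z * g z)))
    (sum-cong-≗ λ z → sym (*-distribˡ-+ (mult G v z) (f z) (g z)))

  weight-1 : ∀ v → weight (λ _ → 1) v ≡ deg v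
  weight-1 v = sum-cong-≗ λ z → *-identityʳ (mult G v z)

  weight-mono-≤ : ∀ {f g} v → (∀ z → f z ≤ g z) → weight f v ≤ weight g v
  weight-mono-≤ v f≤g = sum-mono-≤ λ z → *-monoʳ-≤ (mult G v z) (f≤g z)

-- Adjacent leaves

module Leaves (G : Multigraph n) (simple : Simple G) (connected : Connected G) where

  open Neighbours G simple

  -- No walk starting at `u` can leave the pair `u`, `v`, so connectedness leaves no other vertices.
  adjacent-leaves⇒K₂ : ∀ {u v} → Adj u v → deg u ≡ 1 → deg v ≡ 1 → G ≅ complete 2
  adjacent-leaves⇒K₂ {u} {v} uv du dv = record
    { vertices = mk↔ₛ′ to from to∘from from∘to ; mult-preserve = preserve }
    where
    u≢v = Adj-≢ uv

    reach : ∀ {x y} → x ≡ u ⊎ x ≡ v → Star Adj x y → y ≡ u ⊎ y ≡ v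
    reach x∈          ε        = x∈
    reach (inj₁ refl) (a ◅ as) = reach (inj₂ (deg₁-unique du uv a)) as
    reach (inj₂ refl) (a ◅ as) = reach (inj₁ (deg₁-unique dv (Adj-sym uv) a)) as

    u-or-v : ∀ z → z ≡ u ⊎ z ≡ v
    u-or-v z = reach (inj₁ refl) (connected u z)

    to : Fin n → Fin 2
    to z = if does (z ≟ u) then 0F else 1F

    from : Fin 2 → Fin n
    from 0F = u
    from 1F = v

    to-u : to u ≡ 0F
    to-u rewrite dec-true (u ≟ u) refl = refl

    to-v : to v ≡ 1F
    to-v rewrite dec-false (v ≟ u) (u≢v ∘ sym) = refl

    to∘from : ∀ a → to (from a) ≡ a
    to∘from 0F = to-u
    to∘from 1F = to-v

    from∘to : ∀ z → from (to z) ≡ z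
    from∘to z with u-or-v z
    ... | inj₁ refl = cong from to-u
    ... | inj₂ refl = cong from to-v

    preserve : ∀ x y → mult (complete 2) (to x) (to y) ≡ mult G x y
    preserve x y with u-or-v x | u-or-v y
    ... | inj₁ refl | inj₁ refl rewrite to-u        = sym (mult-loop G u)
    ... | inj₁ refl | inj₂ refl rewrite to-u | to-v = sym (Adj-mult uv)
    ... | inj₂ refl | inj₁ refl rewrite to-u | to-v = sym (Adj-mult (Adj-sym uv))
    ... | inj₂ refl | inj₂ refl rewrite to-v        = sym (mult-loop G v)

-- Types of the vertices of degree three

module Colouring (G : Multigraph n) (simple : Simple G) (subcubic : Subcubic G)
  (independent : Independent G (λ v → degree G v ≡ 3))
  (leaves-apart : ∀ {u v} → Adjacent G u v → degree G u ≡ 1 → degree G v ≢ 1) where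

  open Neighbours G simple

  -- The end `y` may coincide with `v`. Naming `x` and `y` by equations lets a thread be read from
  -- either end without iterating `other`.
  record Thread (v w x y : Fin n) : Set where
    field
      vw : Adj v w
      dw : deg w ≡ 2
      dx : deg x ≡ 2
      x≡ : other w v ≡ x
      y≡ : other x w ≡ y
      dy : deg y ≡ 3

  IsThread : Fin n → Fin n → Set
  IsThread v w = deg w ≡ 2 × deg (other w v) ≡ 2 × deg (other (other w v) w) ≡ 3

  isThread? : ∀ v w → Dec (IsThread v w)
  isThread? v w = (_ ℕ.≟ 2) ×-dec ((_ ℕ.≟ 2) ×-dec (_ ℕ.≟ 3))

  -- Two ends of equal type must not both be pure on a thread of length three: the
  -- later end mixes its edge.  On a thread from v to itself, one of the two edges is
  -- mixed in type 0 and the other in type 1, so no edge demands both types.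
  tie : (Fin n → Fin 2) → (v w x y : Fin n) → Maybe (Fin 2)
  tie T v w x y with <-cmp y v
  ... | tri< _ _ _ = just (T y)
  ... | tri≈ _ _ _ = just (order w x)
  ... | tri> _ _ _ = nothing

  mixing : (Fin n → Fin 2) → Fin n → Fin n → Maybe (Fin 2)
  mixing T v w =
    if does (isThread? v w) then tie T v w (other w v) (other (other w v) w) else nothing

  -- Only far ends smaller than `v` are consulted, so the types known when `v` is processed already
  -- give the final demands at `v`.
  tie-cong : ∀ {S T} v w x y → (∀ z → z Fin.< v → S z ≡ T z) → tie S v w x y ≡ tie T v w x y
  tie-cong v w x y S≡T with <-cmp y v
  ... | tri< y<v _ _ = cong just (S≡T y y<v)
  ... | tri≈ _ _ _   = refl
  ... | tri> _ _ _   = refl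

  mixing-cong : ∀ {S T} v w → (∀ z → z Fin.< v → S z ≡ T z) → mixing S v w ≡ mixing T v w
  mixing-cong v w S≡T with does (isThread? v w)
  ... | true  = tie-cong v w _ _ S≡T
  ... | false = refl

  demands : (Fin n → Fin 2) → Fin 2 → Fin n → ℕ
  demands T a v = weight (λ w → demand a (mixing T v w)) v

  demands-cong : ∀ {S T} a v → (∀ z → z Fin.< v → S z ≡ T z) → demands S a v ≡ demands T a v
  demands-cong a v S≡T = weight-cong λ {z} _ → cong (demand a) (mixing-cong v z S≡T)

  -- Each of the at most three edges at `v` demands at most one type.
  demands-total : ∀ T v → demands T 0F v + demands T 1F v ≤ 3
  demands-total T v = begin
    demands T 0F v + demands T 1F v   ≡⟨ weight-+ _ _ v ⟩
    weight (λ w → demand 0F (mixing T v w) + demand 1F (mixing T v w)) v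
                                      ≤⟨ weight-mono-≤ v (λ w → demand-total (mixing T v w)) ⟩
    weight (λ _ → 1) v                ≡⟨ weight-1 v ⟩
    deg v                             ≤⟨ subcubic v ⟩
    3                                 ∎
    where open ≤-Reasoning

  chooseType : Fin n → (Fin n → Fin 2) → Fin 2
  chooseType v T = if does (demands T 0F v ≤? 1) then 0F else 1F

  module Types = Greedy toℕ 0F chooseType

  type : Fin n → Fin 2
  type = Types.greedy

  chooseType-demands : ∀ T v → demands T (chooseType v T) v ≤ 1
  chooseType-demands T v with demands T 0F v ≤? 1
  ... | yes ≤1 rewrite dec-true (demands T 0F v ≤? 1) ≤1 = ≤1
  ... | no ≰1  rewrite dec-false (demands T 0F v ≤? 1) ≰1 =
    -- If both types were demanded twice, there would be four demands in all.
    ≮⇒≥ λ 2≤ → <⇒≱ (+-mono-≤ (≰⇒> ≰1) 2≤) (demands-total T v)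

  type-demands : ∀ v → demands type (type v) v ≤ 1
  type-demands v = subst (_≤ 1)
    (demands-cong (type v) v λ z z<v → Types.before-greedy {v} {z} z<v)
    (chooseType-demands (Types.before v) v)

  cubicEdge : Fin n → Fin n → Colour
  cubicEdge v w = typed (type v) (mixing type v w)

  cubicEdge-¬thread : ∀ {v w} → ¬ IsThread v w → cubicEdge v w ≡ just (type v)
  cubicEdge-¬thread {v} {w} ¬th rewrite dec-false (isThread? v w) ¬th = refl

  cubicEdge-thread : ∀ {v w x y} → Thread v w x y → cubicEdge v w ≡
                     typed (type v) (tie type v w x y)
  cubicEdge-thread {v} {w} record { dw = dw ; dx = dx ; x≡ = refl ; y≡ = refl ; dy = dy }
    rewrite dec-true (isThread? v w) (dw , dx , dy) = refl

  cubicEdge-cases : ∀ v w → cubicEdge v w ≡ just (type v) ⊎ cubicEdge v w ≡ nothing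
  cubicEdge-cases v w = typed-cases (type v) (mixing type v w)

  cubicEdge-mixed : ∀ {v w} → cubicEdge v w ≡ nothing → IsThread v w
  cubicEdge-mixed {v} {w} eq with isThread? v w
  ... | yes th = th
  ... | no ¬th with () ← trans (sym eq) (cubicEdge-¬thread ¬th)

  earlier-end : ∀ {y v} w x → v Fin.< y → typed (type v) (tie type v w x y) ≡ just (type v)
  earlier-end {y} {v} w x v<y with <-cmp y v
  ... | tri< _ _ v≮y = contradiction v<y v≮y
  ... | tri≈ _ _ v≮y = contradiction v<y v≮y
  ... | tri> _ _ _   = refl

  later-end : ∀ {y v} w x → y Fin.< v →
              typed (type v) (tie type v w x y) ≡ typed (type v) (just (type y))
  later-end {y} {v} w x y<v with <-cmp y v
  ... | tri< _ _ _   = refl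
  ... | tri≈ y≮v _ _ = contradiction y<v y≮v
  ... | tri> y≮v _ _ = contradiction y<v y≮v

  loop-end : ∀ v w x → typed (type v) (tie type v w x v) ≡ typed (type v) (just (order w x))
  loop-end v w x with <-cmp v v
  ... | tri< _ v≢v _ = contradiction refl v≢v
  ... | tri≈ _ _ _   = refl
  ... | tri> _ v≢v _ = contradiction refl v≢v

  -- The earlier end stays pure in its type. The later end is mixed if the types agree, and pure in
  -- the other colour if they differ.
  ends-≢ : ∀ {v y} w x → v Fin.< y →
    typed (type v) (tie type v w x y) ≢ typed (type y) (tie type y x w v)
  ends-≢ {v} {y} w x v<y eq = just-≢-typed (type v) (type y)
    (trans (sym (earlier-end w x v<y)) (trans eq (later-end x w v<y)))

  -- The two edges at `v` demand different types, so exactly one of them is mixed whatever the type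
  -- of `v`.
  loop-ends-≢ : ∀ v {w x} → w ≢ x →
    typed (type v) (tie type v w x v) ≢ typed (type v) (tie type v x w v)
  loop-ends-≢ v {w} {x} w≢x eq = typed-opposite (type v) (order w x) (begin
    typed (type v) (just (order w x))             ≡⟨ loop-end v w x ⟨
    typed (type v) (tie type v w x v)             ≡⟨ eq ⟩
    typed (type v) (tie type v x w v)             ≡⟨ loop-end v x w ⟩
    typed (type v) (just (order x w))             ≡⟨ cong (typed (type v) ∘ just) (order-opposite w≢x) ⟩
    typed (type v) (just (opposite (order w x)))  ∎)
    where open ≡-Reasoning

  all-ends-≢ : ∀ {v w x y} → Tri (v Fin.< y) (v ≡ y) (y Fin.< v) → w ≢ x →
    typed (type v) (tie type v w x y) ≢ typed (type y) (tie type y x w v)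
  all-ends-≢ {w = w} {x} (tri< v<y _ _) _    = ends-≢ w x v<y
  all-ends-≢ {v}         (tri≈ _ refl _) w≢x = loop-ends-≢ v w≢x
  all-ends-≢ {w = w} {x} (tri> _ _ y<v) _    = ends-≢ x w y<v ∘ sym

  thread-ends : ∀ {v w x y} → Thread v w x y → Thread y x w v → w ≢ x → cubicEdge v w ≢ cubicEdge y x
  thread-ends {v} {y = y} th th′ w≢x eq = all-ends-≢ (<-cmp v y) w≢x
    (trans (sym (cubicEdge-thread th)) (trans eq (cubicEdge-thread th′)))

  -- Edges at leaves and between vertices of degree two

  -- The colour of a leaf edge at u whose other end v has degree two; w and x are
  -- the next vertices, with their degrees.
  leafBy : (u : Fin n) (dw : ℕ) (w : Fin n) (dx : ℕ) (x : Fin n) → Fin 2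
  leafBy u 3 w _ x = type w
  leafBy u 2 w 3 x = opposite (type x)
  leafBy u 2 w 1 x = order u x
  leafBy u _ w _ x = 0F

  -- If `w` is cubic or a leaf, then `vw` is pure and `uv` shares its colour. If `w` has degree two
  -- and is followed by a cubic vertex or a leaf, `uv` must differ from the edge beyond `w`.
  -- Otherwise that edge is greedy and adapts, so any colour serves.
  leaf : Fin n → Fin n → Fin 2
  leaf u v = let w = other v u ; x = other w v in leafBy u (deg w) w (deg x) x

  leafEdge : Fin n → Fin n → ℕ → Colour
  leafEdge u v 3 = cubicEdge v u
  leafEdge u v _ = just (leaf u v)

  Table : Set
  Table = Fin n × Fin n → Colour

  -- The degrees are separate arguments so that equations for them make the clauses compute. The
  -- table matters only between vertices of degree two.
  colourBy : Table → (u v : Fin n) → ℕ → ℕ → Colour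
  colourBy T u v 3 _  = cubicEdge u v
  colourBy T u v 1 dv = leafEdge u v dv
  colourBy T u v _ 3  = cubicEdge v u
  colourBy T u v _ 1  = just (leaf v u)
  colourBy T u v _ _  = T (sort u v)

  colourWith : Table → Fin n → Fin n → Colour
  colourWith T u v = colourBy T u v (deg u) (deg v)

  -- Each clause protects the edge `vw`. If `w` is cubic and `vw` mixed, `v` needs a second copy of
  -- the colour opposite to the type of `w`; a leaf `w` needs a further copy of its colour at `v`;
  -- if `w` has degree two, its other edge must be treated differently from `uv`.
  forbiddenBy : Table → (v w : Fin n) → ℕ → Colour
  forbiddenBy T v w 3 = just (type w)
  forbiddenBy T v w 1 = just (opposite (leaf w v))
  forbiddenBy T v w _ = colourWith T w (other w v)

  -- The colour that an edge uv between vertices of degree two must avoid because of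
  -- what lies beyond v.
  forbidden : Table → Fin n → Fin n → Colour
  forbidden T u v = let w = other v u in forbiddenBy T v w (deg w)

  -- Injective, so that of two different edges the later one sees the earlier.
  rank : Fin n × Fin n → ℕ
  rank (u , v) = toℕ (combine u v)

  chooseColour : Fin n × Fin n → Table → Colour
  chooseColour (u , v) T = avoid (forbidden T u v) (forbidden T v u)

  -- A pending edge reads as mixed. This may forbid an option needlessly, which is harmless: `avoid`
  -- copes with any two forbidden options.
  module Edges = Greedy rank nothing chooseColour

  colour : Fin n → Fin n → Colour
  colour = colourWith Edges.greedy

  earlier : Fin n → Fin n → Table
  earlier u v = Edges.before (sort u v)

  colourWith≡ : ∀ {T u v du dv} → deg u ≡ du → deg v ≡ dv → colourWith T u v ≡ colourBy T u v du dv
  colourWith≡ {T} {u} {v} = cong₂ (colourBy T u v)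

  greedy-≢ : ∀ {u v} → Edges.greedy (sort u v) ≢ forbidden (earlier u v) u v
  greedy-≢ {u} {v} with sort u v | sort-cases u v
  ... | _ | inj₁ refl = avoid-≢ˡ _ _
  ... | _ | inj₂ refl = avoid-≢ʳ _ _

  colour₂₂ : ∀ {u v} → deg u ≡ 2 → deg v ≡ 2 → colour u v ≡ Edges.greedy (sort u v)
  colour₂₂ = colourWith≡

  forbidden≡ : ∀ {T u v w d} → other v u ≡ w → deg w ≡ d → forbidden T u v ≡ forbiddenBy T v w d
  forbidden≡ refl refl = refl

  -- The condition on an edge joining two vertices of degree two

  Degree : Fin n → Set
  Degree v = deg v ≡ 1 ⊎ deg v ≡ 2 ⊎ deg v ≡ 3

  Adj-Degree : ∀ {u v} → Adj u v → Degree u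
  Adj-Degree {u} uv = cases (deg u) (Adj⇒1≤deg uv) (subcubic u)
    where
    cases : ∀ d → 1 ≤ d → d ≤ 3 → d ≡ 1 ⊎ d ≡ 2 ⊎ d ≡ 3
    cases 1 _ _ = inj₁ refl
    cases 2 _ _ = inj₂ (inj₁ refl)
    cases 3 _ _ = inj₂ (inj₂ refl)
    cases (suc (suc (suc (suc _)))) _ (s≤s (s≤s (s≤s ())))

  -- The ends `p` and `q` may coincide, in which case the path closes to a triangle.
  record Middle (p u v q : Fin n) : Set where
    field
      du : deg u ≡ 2
      dv : deg v ≡ 2
      uv : Adj u v
      up : Adj u p
      vq : Adj v q
      p≢v : p ≢ v
      q≢u : q ≢ u

  Middle-sym : ∀ {p u v q} → Middle p u v q → Middle q v u p
  Middle-sym m = record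
    { du = dv ; dv = du ; uv = Adj-sym uv ; up = vq ; vq = up ; p≢v = q≢u ; q≢u = p≢v }
    where open Middle m

  module _ {p u v q : Fin n} (m : Middle p u v q) where
    open Middle m

    other-u-p : other u p ≡ v
    other-u-p = other-unique du up uv (p≢v ∘ sym)

    other-u-v : other u v ≡ p
    other-u-v = other-unique du uv up p≢v

    other-v-u : other v u ≡ q
    other-v-u = other-unique dv (Adj-sym uv) vq q≢u

    other-v-q : other v q ≡ u
    other-v-q = other-unique dv vq (Adj-sym uv) (q≢u ∘ sym)

    Middle-thread : deg q ≡ 3 → Thread p u v q
    Middle-thread dq = record
      { vw = Adj-sym up ; dw = du ; dx = dv ; x≡ = other-u-p ; y≡ = other-v-u ; dy = dq }

    Middle-pure : deg q ≢ 3 → cubicEdge p u ≡ just (type p)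
    Middle-pure dq≢3 = cubicEdge-¬thread λ (_ , _ , d) → dq≢3
      (trans (cong deg (sym (trans (cong (λ z → other z u) other-u-p) other-v-u))) d)

    Middle-leaf : ∀ {d} → deg q ≡ d → leaf p u ≡ leafBy p 2 v d q
    Middle-leaf refl = trans
      (cong (λ z → leafBy p (deg z) z (deg (other z u)) (other z u)) other-u-p)
      (cong₂ (λ d z → leafBy p d v (deg z) z) dv other-v-u)

    colour-up₃ : deg p ≡ 3 → colour u p ≡ cubicEdge p u
    colour-up₃ = colourWith≡ du

    colour-up₁ : deg p ≡ 1 → colour u p ≡ just (leaf p u)
    colour-up₁ = colourWith≡ du

    -- Whatever is decided before the edge vq is final: the edge up is greedy only
    -- when p has degree two.
    greedy-conflict : deg q ≡ 2 → (deg p ≡ 2 → rank (sort u p) < rank (sort v q)) →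
                      colour u p ≢ colour v q
    greedy-conflict dq before eq = greedy-≢ {q} {v} (begin
      Edges.greedy (sort q v)                          ≡⟨ cong Edges.greedy (sort-sym q v) ⟩
      Edges.greedy (sort v q)                          ≡⟨ colour₂₂ dv dq ⟨
      colour v q                                       ≡⟨ eq ⟨
      colour u p                                       ≡⟨ final (Adj-Degree (Adj-sym up)) ⟨
      colourWith (earlier q v) u p                     ≡⟨ cong (colourWith (earlier q v) u) other-u-v ⟨
      colourWith (earlier q v) u (other u v)           ≡⟨ forbidden≡ {earlier q v} other-v-q du ⟨
      forbidden (earlier q v) q v                      ∎)
      where
      open ≡-Reasoning
      final : Degree p → colourWith (earlier q v) u p ≡ colour u p
      final (inj₁ d)        = trans (colourWith≡ du d) (sym (colour-up₁ d))
      final (inj₂ (inj₂ d)) = trans (colourWith≡ du d) (sym (colour-up₃ d))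
      final (inj₂ (inj₁ d)) = trans (colourWith≡ du d) (trans
        (Edges.before-greedy {sort q v} {sort u p}
          (subst (λ e → rank (sort u p) < rank e) (sort-sym v q) (before d)))
        (sym (colour₂₂ du d)))

    ranks-≢ : rank (sort u p) ≢ rank (sort v q)
    ranks-≢ eq = sort-≢ {u = u} {p} {v} {q} (Adj-≢ uv ∘ sym) (p≢v ∘ sym)
      (let e , f = combine-injective _ _ _ _ (toℕ-injective eq) in cong₂ _,_ e f)

  -- As the path ends in a leaf, the edge at `p` is not mixed but pure in the type of `p`; the leaf
  -- edge was given the opposite colour for this reason.
  conflict₃₁ : ∀ {p u v q} → Middle p u v q → deg p ≡ 3 → deg q ≡ 1 → colour u p ≢ colour v q
  conflict₃₁ {p} {u} {v} {q} m dp dq eq = opposite-≢ (type p) (just-injective (begin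
    just (type p)             ≡⟨ Middle-pure m (λ dq′ → 1≢3 (trans (sym dq) dq′)) ⟨
    cubicEdge p u             ≡⟨ colour-up₃ m dp ⟨
    colour u p                ≡⟨ eq ⟩
    colour v q                ≡⟨ colour-up₁ (Middle-sym m) dq ⟩
    just (leaf q v)           ≡⟨ cong just (Middle-leaf (Middle-sym m) dp) ⟩
    just (opposite (type p))  ∎))
    where
    open ≡-Reasoning
    1≢3 : 1 ≢ 3
    1≢3 ()

  conflict₃₃ : ∀ {p u v q} → Middle p u v q → deg p ≡ 3 → deg q ≡ 3 → colour u p ≢ colour v q
  conflict₃₃ {p} {u} {v} {q} m dp dq eq =
    thread-ends (Middle-thread m dq) (Middle-thread (Middle-sym m) dp) (Adj-≢ (Middle.uv m))
      (trans (sym (colour-up₃ m dp)) (trans eq (colour-up₃ (Middle-sym m) dq)))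

  conflict₁₁ : ∀ {p u v q} → Middle p u v q → deg p ≡ 1 → deg q ≡ 1 → colour u p ≢ colour v q
  conflict₁₁ {p} {u} {v} {q} m dp dq eq = opposite-≢ (order p q) (just-injective (begin
    just (order p q)             ≡⟨ cong just (Middle-leaf m dq) ⟨
    just (leaf p u)              ≡⟨ colour-up₁ m dp ⟨
    colour u p                   ≡⟨ eq ⟩
    colour v q                   ≡⟨ colour-up₁ (Middle-sym m) dq ⟩
    just (leaf q v)              ≡⟨ cong just (Middle-leaf (Middle-sym m) dp) ⟩
    just (order q p)             ≡⟨ cong just (order-opposite p≢q) ⟩
    just (opposite (order p q))  ∎))
    where
    open ≡-Reasoning
    open Middle m
    -- A common end would be a leaf with the two neighbours `u` and `v`.
    p≢q : p ≢ q
    p≢q refl = Adj-≢ uv (deg₁-unique dp (Adj-sym vq) (Adj-sym up))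

  -- Both edges are greedy and their ranks differ, so the later one has avoided the earlier one.
  conflict₂₂ : ∀ {p u v q} → Middle p u v q → deg p ≡ 2 → deg q ≡ 2 → colour u p ≢ colour v q
  conflict₂₂ {p} {u} {v} {q} m dp dq eq with ℕ.<-cmp (rank (sort u p)) (rank (sort v q))
  ... | tri< r< _ _ = greedy-conflict m dq (λ _ → r<) eq
  ... | tri≈ _ r≡ _ = ranks-≢ m r≡
  ... | tri> _ _ r> = greedy-conflict (Middle-sym m) dp (λ _ → r>) (sym eq)

  middle-≢ : ∀ {p u v q} → Middle p u v q → colour u p ≢ colour v q
  middle-≢ {p} {u} {v} {q} m = cases (Adj-Degree (Adj-sym up)) (Adj-Degree (Adj-sym vq))
    where
    open Middle m
    1≢2 : ∀ {z} {A : Set} → deg z ≡ 1 → deg z ≡ 2 → A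
    1≢2 d d′ with () ← trans (sym d) d′
    3≢2 : ∀ {z} {A : Set} → deg z ≡ 3 → deg z ≡ 2 → A
    3≢2 d d′ with () ← trans (sym d) d′
    cases : Degree p → Degree q → colour u p ≢ colour v q
    cases (inj₁ dp)        (inj₁ dq)        = conflict₁₁ m dp dq
    cases (inj₁ dp)        (inj₂ (inj₁ dq)) = greedy-conflict m dq (1≢2 dp)
    cases (inj₁ dp)        (inj₂ (inj₂ dq)) = conflict₃₁ (Middle-sym m) dq dp ∘ sym
    cases (inj₂ (inj₁ dp)) (inj₁ dq)        = greedy-conflict (Middle-sym m) dp (1≢2 dq) ∘ sym
    cases (inj₂ (inj₁ dp)) (inj₂ (inj₁ dq)) = conflict₂₂ m dp dq
    cases (inj₂ (inj₁ dp)) (inj₂ (inj₂ dq)) = greedy-conflict (Middle-sym m) dp (3≢2 dq) ∘ sym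
    cases (inj₂ (inj₂ dp)) (inj₁ dq)        = conflict₃₁ m dp dq
    cases (inj₂ (inj₂ dp)) (inj₂ (inj₁ dq)) = greedy-conflict m dq (3≢2 dp)
    cases (inj₂ (inj₂ dp)) (inj₂ (inj₂ dq)) = conflict₃₃ m dp dq

  -- The clauses treat the ends asymmetrically only between two leaves or two cubic vertices, and no
  -- such pair is adjacent.
  colour-sym : ∀ {u v} → Adj u v → colour u v ≡ colour v u
  colour-sym {u} {v} uv = cases (Adj-Degree uv) (Adj-Degree (Adj-sym uv))
    where
    by : ∀ {i j} → deg u ≡ i → deg v ≡ j →
         colourBy Edges.greedy u v i j ≡ colourBy Edges.greedy v u j i → colour u v ≡ colour v u
    by refl refl eq = eq
    cases : Degree u → Degree v → colour u v ≡ colour v u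
    cases (inj₁ du)        (inj₁ dv)        = contradiction dv (leaves-apart uv du)
    cases (inj₁ du)        (inj₂ (inj₁ dv)) = by du dv refl
    cases (inj₁ du)        (inj₂ (inj₂ dv)) = by du dv refl
    cases (inj₂ (inj₁ du)) (inj₁ dv)        = by du dv refl
    cases (inj₂ (inj₁ du)) (inj₂ (inj₁ dv)) = by du dv (cong Edges.greedy (sort-sym u v))
    cases (inj₂ (inj₁ du)) (inj₂ (inj₂ dv)) = by du dv refl
    cases (inj₂ (inj₂ du)) (inj₁ dv)        = by du dv refl
    cases (inj₂ (inj₂ du)) (inj₂ (inj₁ dv)) = by du dv refl
    cases (inj₂ (inj₂ du)) (inj₂ (inj₂ dv)) = contradiction uv (independent u v du dv)

  -- Degrees in the colour classes

  load : Fin 2 → Fin n → ℕ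
  load a v = weight (λ z → copies a (colour v z)) v

  load-complement : ∀ a v → load a v + load (opposite a) v ≡ deg v + deg v
  load-complement a v = begin
    load a v + load (opposite a) v           ≡⟨ weight-+ _ _ v ⟩
    weight (λ z → copies a (colour v z) + copies (opposite a) (colour v z)) v
                                             ≡⟨ weight-cong {v = v} (λ {z} _ →
                                                  copies-complement a (colour v z)) ⟩
    weight (λ _ → 1 + 1) v                   ≡⟨ weight-+ _ _ v ⟨
    weight (λ _ → 1) v + weight (λ _ → 1) v  ≡⟨ cong₂ _+_ (weight-1 v) (weight-1 v) ⟩
    deg v + deg v                            ∎
    where open ≡-Reasoning

  load-minor : ∀ {v} → deg v ≡ 3 → load (opposite (type v)) v ≤ 1
  load-minor {v} d = subst (_≤ 1) (sym (weight-cong {v = v} pointwise)) (type-demands v)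
    where
    pointwise : ∀ {z} → Adj v z →
                copies (opposite (type v)) (colour v z) ≡ demand (type v) (mixing type v z)
    pointwise {z} _ = trans (cong (copies (opposite (type v))) (colourWith≡ {v = z} d refl))
      (copies-typed (type v) (mixing type v z))

  -- At most one of the six copies at `v` lies outside its type. Five exceeds the load of any
  -- neighbour, which has degree at most two.
  load-major : ∀ {v} → deg v ≡ 3 → 5 ≤ load (type v) v
  load-major {v} d = +-cancelʳ-≤ 1 5 _ (begin
    6                                                ≡⟨ cong₂ _+_ d d ⟨
    deg v + deg v                                    ≡⟨ load-complement (type v) v ⟨
    load (type v) v + load (opposite (type v)) v     ≤⟨ +-monoʳ-≤ _ (load-minor d) ⟩
    load (type v) v + 1                              ∎)
    where open ≤-Reasoning

  load₁ : ∀ a {u v} → deg u ≡ 1 → Adj u v → load a u ≡ copies a (colour u v)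
  load₁ a {u} = weight₁ (λ z → copies a (colour u z))

  load₂ : ∀ a {u v} → deg u ≡ 2 → Adj u v →
          load a u ≡ copies a (colour u v) + copies a (colour u (other u v))
  load₂ a {u} = weight₂ (λ z → copies a (colour u z))

  load≤4 : ∀ a {w v} → Adj w v → deg w ≢ 3 → load a w ≤ 4
  load≤4 a {w} {v} wv d≢3 with Adj-Degree wv
  ... | inj₁ d        = subst (_≤ 4) (sym (load₁ a d wv))
    (≤-trans (copies≤2 a (colour w v)) (s≤s (s≤s z≤n)))
  ... | inj₂ (inj₁ d) = subst (_≤ 4) (sym (load₂ a d wv))
    (+-mono-≤ (copies≤2 a (colour w v)) (copies≤2 a (colour w (other w v))))
  ... | inj₂ (inj₂ d) = contradiction d d≢3

  Irregular : Fin 2 → Fin n → Fin n → Set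
  Irregular a u v = 1 ≤ copies a (colour u v) → load a u ≢ load a v

  Irregular-sym : ∀ {a u v} → Adj u v → Irregular a v u → Irregular a u v
  Irregular-sym {a} uv irr 1≤ eq = irr (subst (λ κ → 1 ≤ copies a κ) (colour-sym uv) 1≤) (sym eq)

  -- A mixed edge starts a thread, so the next edge joins vertices of degree two and was coloured
  -- greedily with the type of `v` forbidden.
  mixed-next : ∀ {v w} → Adj w v → deg v ≡ 3 → IsThread v w → colour w (other w v) ≢ just (type v)
  mixed-next {v} {w} wv dv (dw , dx , _) eq = greedy-≢ {x} {w} (begin
    Edges.greedy (sort x w)        ≡⟨ cong Edges.greedy (sort-sym x w) ⟩
    Edges.greedy (sort w x)        ≡⟨ colour₂₂ dw dx ⟨
    colour w x                     ≡⟨ eq ⟩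
    just (type v)                  ≡⟨ forbidden≡ {earlier x w} (other-involutive dw wv) dv ⟨
    forbidden (earlier x w) x w    ∎)
    where
    open ≡-Reasoning
    x = other w v

  -- In the type of `v` the loads are at least 5 against at most 4. The opposite colour occurs on
  -- `vw` only if `vw` is mixed; then `v` has load at most 1, while `w` gets one copy from `vw` and
  -- another from its next edge.
  irregular₃ : ∀ a {v w} → Adj v w → deg v ≡ 3 → Irregular a v w
  irregular₃ a {v} {w} vw dv 1≤ eq with ≡-or-opposite (type v) a
  ... | inj₁ refl = <⇒≱ (load-major dv)
    (subst (_≤ 4) (sym eq) (load≤4 a (Adj-sym vw) (λ dw → independent v w dv dw vw)))
  ... | inj₂ refl with cubicEdge-cases v w
  ...   | inj₁ pure = contradiction
    (copies-just (subst (λ κ → 1 ≤ copies a κ) (trans (colourWith≡ {v = w} dv refl) pure) 1≤))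
    (opposite-≢ (type v))
  ...   | inj₂ mixed = <⇒≱ (begin
    2                                                        ≤⟨ +-mono-≤ 1≤wv 1≤wx ⟩
    copies a (colour w v) + copies a (colour w (other w v))  ≡⟨ load₂ a (proj₁ thread) wv ⟨
    load a w                                                 ≡⟨ eq ⟨
    load a v                                                 ∎)
    (load-minor dv)
    where
    open ≤-Reasoning
    wv = Adj-sym vw
    thread = cubicEdge-mixed mixed
    1≤wv : 1 ≤ copies a (colour w v)
    1≤wv = subst (λ κ → 1 ≤ copies a κ) (colour-sym vw) 1≤
    1≤wx : 1 ≤ copies a (colour w (other w v))
    1≤wx = 1≤copies λ e → mixed-next wv dv thread (trans e (cong just (opposite-involutive (type v))))

  leaf≡ : ∀ {u v w d} → other v u ≡ w → deg w ≡ d →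
          leaf u v ≡ leafBy u d w (deg (other w v)) (other w v)
  leaf≡ refl refl = refl

  -- The next edge is pure in the colour of the leaf edge if `w` is a leaf or cubic, and greedy with
  -- this option forbidden if `w` has degree two.
  leaf-next : ∀ {u v} → deg u ≡ 1 → deg v ≡ 2 → Adj v u →
              colour v (other v u) ≢ just (opposite (leaf u v))
  leaf-next {u} {v} du dv vu = cases (Adj-Degree (Adj-sym vw))
    where
    open ≡-Reasoning
    w = other v u
    vw = other-Adj dv vu
    back = other-involutive dv vu

    same : ∀ {a} → leaf u v ≡ a → colour v w ≡ just a → colour v w ≢ just (opposite (leaf u v))
    same refl e e′ = opposite-≢ (leaf u v) (just-injective (trans (sym e) e′))

    -- Seen from `w`, the path through `v` stops at the leaf `u`, so a cubic `w` does not mix its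
    -- edge to `v`.
    ¬thread : ¬ IsThread w v
    ¬thread (_ , d , _) with () ← trans (sym du) (trans (cong deg (sym back)) d)

    cases : Degree w → colour v w ≢ just (opposite (leaf u v))
    cases (inj₁ dw)        = same {0F} (leaf≡ {u} refl dw)
      (trans (colourWith≡ dv dw) (cong just (leaf≡ {w} back du)))
    cases (inj₂ (inj₂ dw)) = same (leaf≡ {u} refl dw)
      (trans (colourWith≡ dv dw) (cubicEdge-¬thread ¬thread))
    cases (inj₂ (inj₁ dw)) eq = greedy-≢ {w} {v} (begin
      Edges.greedy (sort w v)        ≡⟨ cong Edges.greedy (sort-sym w v) ⟩
      Edges.greedy (sort v w)        ≡⟨ colour₂₂ dv dw ⟨
      colour v w                     ≡⟨ eq ⟩
      just (opposite (leaf u v))     ≡⟨ forbidden≡ {earlier w v} back du ⟨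
      forbidden (earlier w v) w v    ∎)

  -- Besides the copies shared with the leaf, `v` has a further copy of `a` on its other edge.
  irregular₁₂ : ∀ a {u v} → Adj u v → deg u ≡ 1 → deg v ≡ 2 → Irregular a u v
  irregular₁₂ a {u} {v} uv du dv 1≤ eq = <-irrefl eq (begin-strict
    load a u                                                   ≡⟨ load₁ a du uv ⟩
    copies a (colour u v)                                      ≡⟨ cong (copies a) (colour-sym uv) ⟩
    copies a (colour v u)                                      <⟨ m<m+n _ (1≤copies next) ⟩
    copies a (colour v u) + copies a (colour v (other v u))    ≡⟨ load₂ a dv (Adj-sym uv) ⟨
    load a v                                                   ∎)
    where
    open ≤-Reasoning
    leaf-a : leaf u v ≡ a
    leaf-a = copies-just (subst (λ κ → 1 ≤ copies a κ) (colourWith≡ du dv) 1≤)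
    next : colour v (other v u) ≢ just (opposite a)
    next = subst (λ b → colour v (other v u) ≢ just (opposite b)) leaf-a (leaf-next du dv (Adj-sym uv))

  -- The contribution of `uv` cancels, and equal numbers of copies of `a` would mean that the two
  -- outer edges are treated alike.
  irregular₂₂ : ∀ a {u v} → Adj u v → deg u ≡ 2 → deg v ≡ 2 → Irregular a u v
  irregular₂₂ a {u} {v} uv du dv _ eq = middle-≢
    record { du = du ; dv = dv ; uv = uv ; up = other-Adj du uv ; vq = other-Adj dv vu
           ; p≢v = other-≢ du uv ; q≢u = other-≢ dv vu }
    (copies-injective a (+-cancelˡ-≡ (copies a (colour u v)) _ _ (begin
      copies a (colour u v) + copies a (colour u (other u v))  ≡⟨ load₂ a du uv ⟨
      load a u                                                 ≡⟨ eq ⟩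
      load a v                                                 ≡⟨ load₂ a dv vu ⟩
      copies a (colour v u) + copies a (colour v (other v u))
        ≡⟨ cong (_+ copies a (colour v (other v u))) (cong (copies a) (colour-sym uv)) ⟨
      copies a (colour u v) + copies a (colour v (other v u))  ∎)))
    where
    open ≡-Reasoning
    vu = Adj-sym uv

  irregular : ∀ a {u v} → Adj u v → Irregular a u v
  irregular a {u} {v} uv = cases (Adj-Degree uv) (Adj-Degree vu)
    where
    vu = Adj-sym uv
    cases : Degree u → Degree v → Irregular a u v
    cases (inj₂ (inj₂ du)) _                = irregular₃ a uv du
    cases _                (inj₂ (inj₂ dv)) = Irregular-sym uv (irregular₃ a vu dv)
    cases (inj₁ du)        (inj₁ dv)        = contradiction dv (leaves-apart uv du)
    cases (inj₁ du)        (inj₂ (inj₁ dv)) = irregular₁₂ a uv du dv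
    cases (inj₂ (inj₁ du)) (inj₁ dv)        = Irregular-sym uv (irregular₁₂ a vu dv du)
    cases (inj₂ (inj₁ du)) (inj₂ (inj₁ dv)) = irregular₂₂ a uv du dv

  -- The colouring of the doubled graph

  colouring : EdgeColouring (² G) 2
  colouring (edge u v _ i) = paint (colour u v) (toℕ i)

  colourMult≡ : ∀ a u v → colourMult (² G) colouring a u v ≡ mult G u v * copies a (colour u v)
  colourMult≡ a u v with <-cmp u v
  ... | tri< _ _ _    = count-paint _ (simple u v) (colour u v) a
  ... | tri≈ _ refl _ = cong (_* copies a (colour u u)) (sym (mult-loop G u))
  ... | tri> _ _ _    = trans (count-paint _ (simple v u) (colour v u) a) swap
    where
    swap : mult G v u * copies a (colour v u) ≡ mult G u v * copies a (colour u v)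
    swap with 1 ≤? mult G u v
    ... | yes uv = cong₂ _*_ (mult-sym G v u) (cong (copies a) (sym (colour-sym uv)))
    -- Off the edges `colour` need not be symmetric, but there the multiplicity vanishes.
    ... | no ¬uv rewrite mult-sym G v u | ¬Adj-mult ¬uv = refl

  degree≡ : ∀ a v → degree (colourClass (² G) colouring a) v ≡ load a v
  degree≡ a v = sum-cong-≗ (colourMult≡ a v)

  colouring-irregular : IsLocallyIrregular (² G) colouring
  colouring-irregular a u v uv eq = irregular a (factors₁ _ 1≤) (factors₂ (mult G u v) _ 1≤)
    (trans (sym (degree≡ a u)) (trans eq (degree≡ a v)))
    where
    1≤ : 1 ≤ mult G u v * copies a (colour u v)
    1≤ = subst (1 ≤_) (colourMult≡ a u v) uv
    factors₁ : ∀ {m} k → 1 ≤ m * k → 1 ≤ m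
    factors₁ {suc m} k _ = s≤s z≤n
    factors₂ : ∀ m k → 1 ≤ m * k → 1 ≤ k
    factors₂ m zero    1≤ = contradiction (subst (1 ≤_) (*-zeroʳ m) 1≤) λ ()
    factors₂ m (suc k) _  = s≤s z≤n

theorem14 : ∀ {n : ℕ} (G : Multigraph n) →
    Simple G → Connected G → Subcubic G → ¬ (G ≅ complete 2) →
    Independent G (λ v → degree G v ≡ 3) →
    Lir≤ (² G) 2
theorem14 G simple connected subcubic G≇K₂ independent = colouring , colouring-irregular
  where
  open Colouring G simple subcubic independent
    (λ uv du dv → G≇K₂ (Leaves.adjacent-leaves⇒K₂ G simple connected uv du dv))
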